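{- Let $X$ be a finite nonempty alphabet and $\mathcal{L}\subseteq 2^{X^*}$ a nontrivial, WP-recursive language family closed under finite unions, finite intersections and complementation. Let $C,A\subseteq X^*$ be recursive languages with $A$ infinite, $A\cap C=\emptyset$, and $A\notin\mathit{cclass}_1(C,\mathcal{L})$. Then there is a recursive language $B\subseteq A$ with $B\in\mathit{ccore}_1(C,\mathcal{L})$.
   Context: $\mathcal{L}$ is nontrivial if $\emptyset,X^*\in\mathcal{L}$ and for all $Q\in\mathcal{L}$ and finite $E\subseteq X^*$ both $Q\cup E\in\mathcal{L}$ and $Q\setminus E\in\mathcal{L}$. $\mathcal{L}$ is WP-recursive if there is a surjection $e:\mathbb{N}_0\to\mathcal{L}$ such that the predicate "$w\in e(i)$" (for $i\in\mathbb{N}_0$, $w\in X^*$) is decidable (uniformly in $i$ and $w$). For $C\subseteq X^*$ and an infinite $A\subseteq X^*\setminus C$: $A\in\mathit{cclass}_1(C,\mathcal{L})$ iff there is $Q\in\mathcal{L}$ with $X^*\setminus Q\in\mathcal{L}$, $C\subseteq Q$ and $A\subseteq X^*\setminus Q$; $B\in\mathit{ccore}_1(C,\mathcal{L})$ iff $B$ is an infinite subset of $X^*\setminus C$ and every infinite $B'\subseteq B$ satisfies $B'\notin\mathit{cclass}_1(C,\mathcal{L})$. -}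

module Defs where

open import Data.Fin using (Fin; toℕ)
open import Data.List using (List; []; _∷_)
open import Data.List.Membership.Propositional using () renaming (_∈_ to _∈ˡ_)
open import Data.Nat using (ℕ; zero; suc; _+_; _*_; _<_)
open import Data.Product using (∃; _×_)
open import Data.Vec using (Vec; []; _∷_; lookup)
open import Data.Vec.Relation.Binary.Pointwise.Inductive using (Pointwise)
open import Function.Bundles using (_↔_; Inverse)
open import Level using (Level; 0ℓ) renaming (suc to lsuc; _⊔_ to _⊔ˡ_)
open import Relation.Binary.Definitions using (_Respects_)
open import Relation.Nullary using (¬_)
open import Relation.Unary using (Pred; _∈_; _∉_; _⊆_; _≐_; ∅; U; ∁; _∪_; _∩_; _∖_)

private
  variable
    k m : ℕ
    ℓ : Level

-- Kleene's partial (μ-)recursive functions ℕᵏ ⇀ ℕ.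

data Rec : ℕ → Set where
  zeroᴿ : Rec 0
  sucᴿ  : Rec 1
  proj  : Fin k → Rec k
  comp  : Rec m → Vec (Rec k) m → Rec k
  prec  : Rec k → Rec (suc (suc k)) → Rec (suc k)
  μ     : Rec (suc k) → Rec k

-- f [ xs ]⇓ y : the value of f at xs is defined and equals y.

infix 4 _[_]⇓_

data _[_]⇓_ : Rec k → Vec ℕ k → ℕ → Set where
  ⇓-zero : zeroᴿ [ [] ]⇓ 0
  ⇓-suc  : ∀ {x} → sucᴿ [ x ∷ [] ]⇓ suc x
  ⇓-proj : ∀ {i : Fin k} {xs} → proj i [ xs ]⇓ lookup xs i
  ⇓-comp : ∀ {f : Rec m} {gs : Vec (Rec k) m} {xs ys z} →
           Pointwise (λ g y → g [ xs ]⇓ y) gs ys → f [ ys ]⇓ z →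
           comp f gs [ xs ]⇓ z
  ⇓-prec-zero : ∀ {f : Rec k} {g xs y} →
                f [ xs ]⇓ y →
                prec f g [ zero ∷ xs ]⇓ y
  ⇓-prec-suc  : ∀ {f : Rec k} {g xs n r y} →
                prec f g [ n ∷ xs ]⇓ r → g [ n ∷ r ∷ xs ]⇓ y →
                prec f g [ suc n ∷ xs ]⇓ y
  ⇓-μ : ∀ {f : Rec (suc k)} {xs y} →
        f [ y ∷ xs ]⇓ 0 →
        (∀ z → z < y → ∃ λ v → f [ z ∷ xs ]⇓ suc v) →
        μ f [ xs ]⇓ y

-- f takes at xs the truth value of P.

HasTruthValue : Rec k → Vec ℕ k → Set → Set
HasTruthValue f xs P = (P → f [ xs ]⇓ 1) × (¬ P → f [ xs ]⇓ 0)

Language : Set → Set₁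
Language X = Pred (List X) 0ℓ

Finite : {X : Set} → Language X → Set
Finite {X} A = ∃ λ (ws : List (List X)) → A ⊆ (_∈ˡ ws)

Infinite : {X : Set} → Language X → Set
Infinite A = ¬ Finite A

-- Bijective base-(m+1) numeration, least significant digit first; it is a
-- bijection X* → ℕ (the digits are 1, …, m+1 and the empty word is 0).

code : {X : Set} → X ↔ Fin (suc m) → List X → ℕ
code enum []          = 0
code {m} enum (x ∷ w) = suc (toℕ (Inverse.to enum x)) + suc m * code enum w

Recursive : {X : Set} → X ↔ Fin (suc m) → Language X → Set
Recursive enum A = ∃ λ (f : Rec 1) → ∀ w → HasTruthValue f (code enum w ∷ []) (w ∈ A)

-- A subset of 2^(X*). Languages are predicates, so equality of languages is
-- _≐_, which membership in the family has to respect.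

record LanguageFamily (X : Set) (ℓ : Level) : Set (lsuc 0ℓ ⊔ˡ lsuc ℓ) where
  field
    Member   : Pred (Language X) ℓ
    respects : Member Respects _≐_

open LanguageFamily public

infix 4 _∈ᶠ_

_∈ᶠ_ : {X : Set} → Language X → LanguageFamily X ℓ → Set ℓ
Q ∈ᶠ 𝓛 = Member 𝓛 Q

Nontrivial : {X : Set} → LanguageFamily X ℓ → Set (lsuc 0ℓ ⊔ˡ ℓ)
Nontrivial {X = X} 𝓛 =
  (∅ ∈ᶠ 𝓛) × (U ∈ᶠ 𝓛) ×
  (∀ (Q E : Language X) → Q ∈ᶠ 𝓛 → Finite E → ((Q ∪ E) ∈ᶠ 𝓛) × ((Q ∖ E) ∈ᶠ 𝓛))

WPRecursive : {X : Set} → X ↔ Fin (suc m) → LanguageFamily X ℓ → Set (lsuc 0ℓ ⊔ˡ ℓ)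
WPRecursive {X = X} enum 𝓛 =
  ∃ λ (e : ℕ → Language X) →
    (∀ i → e i ∈ᶠ 𝓛) ×
    (∀ (Q : Language X) → Q ∈ᶠ 𝓛 → ∃ λ i → e i ≐ Q) ×
    (∃ λ (f : Rec 2) → ∀ i w → HasTruthValue f (i ∷ code enum w ∷ []) (w ∈ e i))

-- Together with ∅, X* ∈ 𝓛 (part of Nontrivial), the binary closure conditions
-- cover all finite unions and intersections, including the empty ones.

ClosedUnder∪ : {X : Set} → LanguageFamily X ℓ → Set (lsuc 0ℓ ⊔ˡ ℓ)
ClosedUnder∪ {X = X} 𝓛 = ∀ (P Q : Language X) → P ∈ᶠ 𝓛 → Q ∈ᶠ 𝓛 → (P ∪ Q) ∈ᶠ 𝓛

ClosedUnder∩ : {X : Set} → LanguageFamily X ℓ → Set (lsuc 0ℓ ⊔ˡ ℓ)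
ClosedUnder∩ {X = X} 𝓛 = ∀ (P Q : Language X) → P ∈ᶠ 𝓛 → Q ∈ᶠ 𝓛 → (P ∩ Q) ∈ᶠ 𝓛

ClosedUnder∁ : {X : Set} → LanguageFamily X ℓ → Set (lsuc 0ℓ ⊔ˡ ℓ)
ClosedUnder∁ {X = X} 𝓛 = ∀ (Q : Language X) → Q ∈ᶠ 𝓛 → ∁ Q ∈ᶠ 𝓛

cclass₁ : {X : Set} → Language X → LanguageFamily X ℓ → Pred (Language X) (lsuc 0ℓ ⊔ˡ ℓ)
cclass₁ {X = X} C 𝓛 A =
  Infinite A × (A ⊆ ∁ C) ×
  (∃ λ (Q : Language X) → (Q ∈ᶠ 𝓛) × (∁ Q ∈ᶠ 𝓛) × (C ⊆ Q) × (A ⊆ ∁ Q))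

ccore₁ : {X : Set} → Language X → LanguageFamily X ℓ → Pred (Language X) (lsuc 0ℓ ⊔ˡ ℓ)
ccore₁ {X = X} C 𝓛 B =
  Infinite B × (B ⊆ ∁ C) ×
  (∀ (B′ : Language X) → Infinite B′ → B′ ⊆ B → B′ ∉ cclass₁ C 𝓛)

{-# OPTIONS --safe #-}

-- Identify X* with ℕ and write e₀, e₁, … for the members of 𝓛.  Decide the
-- words s = 0, 1, 2, … one after the other, n being the number of words
-- accepted so far: s is accepted iff s ∈ A and s ∈ eᵢ for every i < n for which
-- C ⊆ eᵢ is not yet refuted by a word below s.  This is recursive in the data.
-- If C ⊆ eᵢ, then all words accepted after the first i + 1 lie in eᵢ, so no
-- infinite set of accepted words is separated from C by eᵢ.  If n stopped
-- growing, then, once all false inclusions with i < n are refuted, no further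
-- word of A lies in Q = ⋂ { eᵢ | i < n, C ⊆ eᵢ }; removing the finite set A ∩ Q
-- from Q gives a member of 𝓛 separating C from A.

module Submission where

open import Defs
open import Axiom.ExcludedMiddle using (ExcludedMiddle)
open import Data.Empty using (⊥-elim)
open import Data.Fin using (Fin; zero; suc; toℕ; fromℕ<)
open import Data.Fin.Properties using (toℕ-fromℕ<; toℕ-injective; toℕ<n)
open import Data.List using (List; []; _∷_; map; upTo)
open import Data.List.Extrema.Nat using (max; xs≤max)
open import Data.List.Membership.Propositional using () renaming (_∈_ to _∈ˡ_)
open import Data.List.Membership.Propositional.Properties using (∈-map⁺; ∈-upTo⁺)
open import Data.List.Relation.Unary.All as All using ()
open import Data.Nat using (ℕ; zero; suc; _+_; _*_; _≤_; _<_; _⊔_; s≤s; z≤n)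
open import Data.Nat.DivMod using (_/_; _%_; m%n<n; m≡m%n+[m/n]*n; m/n≤m; [m+kn]%n≡m%n; m<n⇒m%n≡m)
open import Data.Nat.Induction using (<-rec)
open import Data.Nat.Properties
open import Data.Product using (∃; _×_; _,_; proj₁; proj₂)
open import Data.Sum using (inj₁; inj₂)
open import Data.Vec as Vec using (Vec; []; _∷_; lookup; tabulate)
open import Data.Vec.Properties using (tabulate-∘; tabulate∘lookup)
open import Data.Vec.Relation.Binary.Pointwise.Inductive using (Pointwise; []; _∷_)
open import Function.Bundles using (_↔_; Inverse)
open import Level using (Level; 0ℓ)
open import Relation.Binary.PropositionalEquality using (_≡_; refl; sym; trans; cong; cong₂; subst; module ≡-Reasoning)
open import Relation.Nullary using (¬_; yes; no)
open import Relation.Unary using (Pred; _∈_; _∉_; _⊆_; _≐_; ∅; ∁; _∖_; _∩_)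

private
  variable
    k m : ℕ
    P Q : Set

-- Bijective numeration of words

digit-% : ∀ (d : Fin (suc m)) c → (toℕ d + suc m * c) % suc m ≡ toℕ d
digit-% {m} d c = trans (cong (λ x → (toℕ d + x) % suc m) (*-comm (suc m) c))
                  (trans ([m+kn]%n≡m%n (toℕ d) c (suc m)) (m<n⇒m%n≡m (toℕ<n d)))

module _ {X : Set} (enum : X ↔ Fin (suc m)) where

  open Inverse enum using (to; from; strictlyInverseˡ; strictlyInverseʳ)

  code-surjective : ∀ n → ∃ λ w → code enum w ≡ n
  code-surjective = <-rec _ step
    where
    step : ∀ n → (∀ {j} → j < n → ∃ λ w → code enum w ≡ j) → ∃ λ w → code enum w ≡ n
    step zero    rec = [] , refl
    -- The digits start at 1, so it is `n`, not `suc n`, that is divided: the remainder gives the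
    -- first digit, and the quotient, at most `n`, codes the rest of the word.
    step (suc n) rec with rec {n / suc m} (s≤s (m/n≤m n (suc m)))
    ... | w , eq = from d ∷ w , cong suc (begin
      toℕ (to (from d)) + suc m * code enum w ≡⟨ cong₂ (λ x c → toℕ x + suc m * c) (strictlyInverseˡ d) eq ⟩
      toℕ d + suc m * (n / suc m)             ≡⟨ cong₂ _+_ (toℕ-fromℕ< (m%n<n n (suc m))) (*-comm (suc m) (n / suc m)) ⟩
      n % suc m + n / suc m * suc m           ≡⟨ m≡m%n+[m/n]*n n (suc m) ⟨
      n                                       ∎)
      where
      open ≡-Reasoning
      d : Fin (suc m)
      d = fromℕ< (m%n<n n (suc m))

  -- The first digit, less one, is the remainder of the code's predecessor modulo `suc m`; once it
  -- is subtracted, cancelling the factor `suc m` leaves the codes of the tails.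
  code-injective : ∀ v w → code enum v ≡ code enum w → v ≡ w
  code-injective []      []      eq = refl
  code-injective (x ∷ v) (y ∷ w) eq = cong₂ _∷_ x≡y (code-injective v w cv≡cw)
    where
    eq′ : toℕ (to x) + suc m * code enum v ≡ toℕ (to y) + suc m * code enum w
    eq′ = suc-injective eq
    digits : toℕ (to x) ≡ toℕ (to y)
    digits = trans (sym (digit-% (to x) _)) (trans (cong (_% suc m) eq′) (digit-% (to y) _))
    x≡y : x ≡ y
    x≡y = trans (sym (strictlyInverseʳ x)) (trans (cong from (toℕ-injective digits)) (strictlyInverseʳ y))
    cv≡cw : code enum v ≡ code enum w
    cv≡cw = *-cancelˡ-≡ _ _ (suc m)
              (+-cancelˡ-≡ (toℕ (to x)) _ _ (trans eq′ (cong (_+ suc m * code enum w) (sym digits))))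

  decode : ℕ → List X
  decode n = proj₁ (code-surjective n)

  code-decode : ∀ n → code enum (decode n) ≡ n
  code-decode n = proj₂ (code-surjective n)

  decode-code : ∀ w → decode (code enum w) ≡ w
  decode-code w = code-injective _ w (code-decode _)

  -- Since `code` is a bijection, finiteness of a language amounts to a bound on its codes; this is
  -- the form that fits a selection carried out on ℕ.
  BoundedBy : Language X → ℕ → Set
  BoundedBy L N = ∀ {w} → w ∈ L → code enum w < N

  bounded⇒finite : ∀ {L N} → BoundedBy L N → Finite L
  bounded⇒finite {L} {N} bnd = map decode (upTo N) , λ {w} w∈L →
    subst (_∈ˡ map decode (upTo N)) (decode-code w) (∈-map⁺ decode (∈-upTo⁺ (bnd w∈L)))

  finite⇒bounded : ∀ {L} → Finite L → ∃ (BoundedBy L)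
  finite⇒bounded (ws , L⊆ws) = suc (max 0 codes) , λ w∈L →
    s≤s (All.lookup (xs≤max 0 codes) (∈-map⁺ (code enum) (L⊆ws w∈L)))
    where
    codes : List ℕ
    codes = map (code enum) ws

-- Recursive predicates

constᴿ : ℕ → Rec k
constᴿ zero    = comp zeroᴿ []
constᴿ (suc n) = comp sucᴿ (constᴿ n ∷ [])

⇓-const : ∀ n {xs : Vec ℕ k} → constᴿ n [ xs ]⇓ n
⇓-const zero    = ⇓-comp [] ⇓-zero
⇓-const (suc n) = ⇓-comp (⇓-const n ∷ []) ⇓-suc

addᴿ : Rec 2
addᴿ = prec (proj zero) (comp sucᴿ (proj (suc zero) ∷ []))

⇓-add : ∀ x y → addᴿ [ x ∷ y ∷ [] ]⇓ x + y
⇓-add zero    y = ⇓-prec-zero ⇓-proj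
⇓-add (suc x) y = ⇓-prec-suc (⇓-add x y) (⇓-comp (⇓-proj ∷ []) ⇓-suc)

-- ifᴿ a [ x , y ] is a for x = 0 and y otherwise, so that ifᴿ 0 and ifᴿ 1 are
-- conjunction and implication of truth values.

ifᴿ : ℕ → Rec 2
ifᴿ a = prec (constᴿ a) (proj (suc (suc zero)))

⇓-if-zero : ∀ a {y} → ifᴿ a [ 0 ∷ y ∷ [] ]⇓ a
⇓-if-zero a = ⇓-prec-zero (⇓-const a)

⇓-if-one : ∀ a {y} → ifᴿ a [ 1 ∷ y ∷ [] ]⇓ y
⇓-if-one a = ⇓-prec-suc (⇓-if-zero a) ⇓-proj

infixr 6 _∧ᴿ_
infixr 5 _⇒ᴿ_

_∧ᴿ_ _⇒ᴿ_ : Rec k → Rec k → Rec k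
f ∧ᴿ g = comp (ifᴿ 0) (f ∷ g ∷ [])
f ⇒ᴿ g = comp (ifᴿ 1) (f ∷ g ∷ [])

reindex : ∀ {j} → Rec j → Vec (Fin k) j → Rec k
reindex f is = comp f (Vec.map proj is)

⇓-projs : ∀ {j} (is : Vec (Fin k) j) {xs} →
          Pointwise (λ g y → g [ xs ]⇓ y) (Vec.map proj is) (Vec.map (lookup xs) is)
⇓-projs []       = []
⇓-projs (i ∷ is) = ⇓-proj ∷ ⇓-projs is

truth-comp : ∀ {f : Rec m} {gs : Vec (Rec k) m} {xs ys} →
             Pointwise (λ g y → g [ xs ]⇓ y) gs ys →
             HasTruthValue f ys P → HasTruthValue (comp f gs) xs P
truth-comp gs⇓ (t , f) = (λ p → ⇓-comp gs⇓ (t p)) , (λ ¬p → ⇓-comp gs⇓ (f ¬p))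

truth-reindex : ∀ {j} {f : Rec j} (is : Vec (Fin k) j) {xs} →
                HasTruthValue f (Vec.map (lookup xs) is) P → HasTruthValue (reindex f is) xs P
truth-reindex is = truth-comp (⇓-projs is)

truth-map : ∀ {f : Rec k} {xs} → (P → Q) → (Q → P) → HasTruthValue f xs P → HasTruthValue f xs Q
truth-map P→Q Q→P (t , f) = (λ q → t (Q→P q)) , (λ ¬q → f (λ p → ¬q (P→Q p)))

-- In the step of a primitive recursion the counter and the previous value come first; these are the
-- positions of the parameters behind them.
skip₂ : Vec (Fin (suc (suc k))) k
skip₂ = tabulate (λ i → suc (suc i))

lookup-skip₂ : ∀ {x y} (xs : Vec ℕ k) → Vec.map (lookup (x ∷ y ∷ xs)) skip₂ ≡ xs
lookup-skip₂ xs = trans (sym (tabulate-∘ _ _)) (tabulate∘lookup xs)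

allᴿ : Rec (suc k) → Rec (suc k)
allᴿ f = prec (constᴿ 1) (reindex f (zero ∷ skip₂) ∧ᴿ proj (suc zero))

-- Truth values of conjunctions, implications and bounded quantifiers

module Classical (em : ExcludedMiddle 0ℓ) where

  indicator : Set → ℕ
  indicator P with em {P}
  ... | yes _ = 1
  ... | no  _ = 0

  indicator-yes : P → indicator P ≡ 1
  indicator-yes {P} p with em {P}
  ... | yes _ = refl
  ... | no ¬p = ⊥-elim (¬p p)

  indicator-no : ¬ P → indicator P ≡ 0
  indicator-no {P} ¬p with em {P}
  ... | yes p = ⊥-elim (¬p p)
  ... | no _  = refl

  -- Composition is strict: a connective has a value only where both arguments have one, even if the
  -- first alone settles the result. This supplies the other value.
  ⇓-indicator : ∀ {f : Rec k} {xs} → HasTruthValue f xs P → f [ xs ]⇓ indicator P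
  ⇓-indicator {P = P} (t , f) with em {P}
  ... | yes p = t p
  ... | no ¬p = f ¬p

  truth-∧ : ∀ {f g : Rec k} {xs} → HasTruthValue f xs P → HasTruthValue g xs Q →
            HasTruthValue (f ∧ᴿ g) xs (P × Q)
  truth-∧ {P = P} (tf , ff) hg@(tg , fg) =
    (λ (p , q) → ⇓-comp (tf p ∷ tg q ∷ []) (⇓-if-one 0)) , false
    where
    false : ¬ (P × _) → _
    false ¬pq with em {P}
    ... | yes p = ⇓-comp (tf p ∷ fg (λ q → ¬pq (p , q)) ∷ []) (⇓-if-one 0)
    ... | no ¬p = ⇓-comp (ff ¬p ∷ ⇓-indicator hg ∷ []) (⇓-if-zero 0)

  truth-⇒ : ∀ {f g : Rec k} {xs} → HasTruthValue f xs P → HasTruthValue g xs Q →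
            HasTruthValue (f ⇒ᴿ g) xs (P → Q)
  truth-⇒ {P = P} {Q = Q} (tf , ff) hg@(tg , fg) = true , false
    where
    true : (P → Q) → _
    true h with em {P}
    ... | yes p = ⇓-comp (tf p ∷ tg (h p) ∷ []) (⇓-if-one 1)
    ... | no ¬p = ⇓-comp (ff ¬p ∷ ⇓-indicator hg ∷ []) (⇓-if-zero 1)
    false : ¬ (P → Q) → _
    false ¬h with em {P}
    ... | yes p = ⇓-comp (tf p ∷ fg (λ q → ¬h (λ _ → q)) ∷ []) (⇓-if-one 1)
    ... | no ¬p = ⊥-elim (¬h (λ p → ⊥-elim (¬p p)))

  truth-all : ∀ {f : Rec (suc k)} {xs} {R : ℕ → Set} →
              (∀ i → HasTruthValue f (i ∷ xs) (R i)) →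
              ∀ n → HasTruthValue (allᴿ f) (n ∷ xs) (∀ i → i < n → R i)
  truth-all hf zero = (λ _ → ⇓-prec-zero (⇓-const 1)) , (λ ¬h → ⊥-elim (¬h (λ _ ())))
  truth-all {f = f} {xs} {R} hf (suc n) =
    (λ h → ⇓-prec-suc r⇓ (proj₁ last h)) , (λ ¬h → ⇓-prec-suc r⇓ (proj₂ last ¬h))
    where
    r : ℕ
    r = indicator (∀ i → i < n → R i)

    r⇓ : allᴿ f [ n ∷ xs ]⇓ r
    r⇓ = ⇓-indicator (truth-all hf n)

    head : HasTruthValue (reindex f (zero ∷ skip₂)) (n ∷ r ∷ xs) (R n)
    head = truth-reindex (zero ∷ skip₂)
             (subst (λ ys → HasTruthValue f (n ∷ ys) (R n)) (sym (lookup-skip₂ xs)) (hf n))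

    -- The second argument is the recursion value `r` itself, so a projection suffices to read off
    -- the truth value for the smaller bound.
    below : HasTruthValue (proj (suc zero)) (n ∷ r ∷ xs) (∀ i → i < n → R i)
    below = (λ h → subst (proj (suc zero) [ n ∷ r ∷ xs ]⇓_) (indicator-yes h) ⇓-proj)
          , (λ ¬h → subst (proj (suc zero) [ n ∷ r ∷ xs ]⇓_) (indicator-no ¬h) ⇓-proj)

    extend : R n × (∀ i → i < n → R i) → ∀ i → i < suc n → R i
    extend (p , h) i i<1+n with m<1+n⇒m<n∨m≡n i<1+n
    ... | inj₁ i<n  = h i i<n
    ... | inj₂ refl = p

    last : HasTruthValue (reindex f (zero ∷ skip₂) ∧ᴿ proj (suc zero)) (n ∷ r ∷ xs) (∀ i → i < suc n → R i)
    last = truth-map extend (λ h → h n ≤-refl , λ i i<n → h i (m<n⇒m<1+n i<n)) (truth-∧ head below)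

  -- The selection, carried out on ℕ

  module Construction (A C : Pred ℕ 0ℓ) (E : ℕ → Pred ℕ 0ℓ) where

    Unrefuted : ℕ → ℕ → Set
    Unrefuted i s = ∀ c → c < s → c ∈ C → c ∈ E i

    Admissible : ℕ → ℕ → Set
    Admissible n s = s ∈ A × (∀ i → i < n → Unrefuted i s → s ∈ E i)

    -- The number of accepted values below the argument. It is the whole state of the selection, so
    -- a single primitive recursion computes everything.
    count : ℕ → ℕ
    count zero    = 0
    count (suc s) = indicator (Admissible (count s) s) + count s

    Accepted : Pred ℕ 0ℓ
    Accepted s = Admissible (count s) s

    Cofinal : Pred ℕ 0ℓ → Set
    Cofinal S = ∀ N → ∃ λ s → N ≤ s × s ∈ S

    count-mono : ∀ {s t} → s ≤ t → count s ≤ count t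
    count-mono {t = zero}  z≤n = ≤-refl
    count-mono {t = suc t} s≤1+t with m≤n⇒m<n∨m≡n s≤1+t
    ... | inj₁ (s≤s s≤t) = ≤-trans (count-mono s≤t) (m≤n+m _ _)
    ... | inj₂ refl      = ≤-refl

    count-stops : ∀ {N} → (∀ s → N ≤ s → s ∉ Accepted) → ∀ {s} → N ≤ s → count s ≤ count N
    count-stops none {zero}  z≤n = ≤-refl
    count-stops none {suc s} N≤1+s with m≤n⇒m<n∨m≡n N≤1+s
    ... | inj₂ refl = ≤-refl
    ... | inj₁ (s≤s N≤s) rewrite indicator-no (none s N≤s) = count-stops none N≤s

    count-unbounded : Cofinal Accepted → ∀ n → ∃ λ s → n ≤ count s
    count-unbounded cof zero = 0 , z≤n
    count-unbounded cof (suc n) with count-unbounded cof n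
    ... | s , n≤ with cof s
    ... | t , s≤t , acc = suc t ,
      subst (λ b → suc n ≤ b + count t) (sym (indicator-yes acc)) (s≤s (≤-trans n≤ (count-mono s≤t)))

    eventually-in : Cofinal Accepted → ∀ i → C ⊆ E i →
                    ∃ λ N → ∀ s → N ≤ s → s ∈ Accepted → s ∈ E i
    -- A count of at least `suc i` puts `i` among the tested indices, and a true inclusion is never
    -- refuted.
    eventually-in cof i C⊆Eᵢ with count-unbounded cof (suc i)
    ... | N , i<count = N , λ s N≤s (_ , h) →
      h i (≤-trans i<count (count-mono N≤s)) (λ _ _ → C⊆Eᵢ)

    -- A false inclusion has a counterexample `c`, which is seen from `suc c` on; for a true one any
    -- stage will do. The stage exists classically and is never computed.
    refutation-stage : ∀ i → ∃ λ M → ∀ s → M ≤ s → Unrefuted i s → C ⊆ E i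
    refutation-stage i with em {∃ λ c → c ∈ C × c ∉ E i}
    ... | yes (c , c∈C , c∉Eᵢ) = suc c , λ s c<s unref → ⊥-elim (c∉Eᵢ (unref c c<s c∈C))
    ... | no none = 0 , λ _ _ _ → included
      where
      included : C ⊆ E i
      included {c} c∈C with em {c ∈ E i}
      ... | yes c∈Eᵢ = c∈Eᵢ
      ... | no c∉Eᵢ  = ⊥-elim (none (c , c∈C , c∉Eᵢ))

    common-refutation-stage : ∀ n → ∃ λ M → ∀ i → i < n → ∀ s → M ≤ s → Unrefuted i s → C ⊆ E i
    common-refutation-stage zero = 0 , λ _ ()
    common-refutation-stage (suc n) with common-refutation-stage n | refutation-stage n
    ... | M , below | M′ , at = M ⊔ M′ , stage
      where
      stage : ∀ i → i < suc n → ∀ s → M ⊔ M′ ≤ s → Unrefuted i s → C ⊆ E i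
      stage i i<1+n s ≤s with m<1+n⇒m<n∨m≡n i<1+n
      ... | inj₁ i<n  = below i i<n s (m⊔n≤o⇒m≤o M M′ ≤s)
      ... | inj₂ refl = at s (m⊔n≤o⇒n≤o M M′ ≤s)

    -- In contrast to `Admissible`, this asks about the true inclusions, not the unrefuted ones, and
    -- so is a fixed finite intersection.
    Cover : ℕ → Pred ℕ 0ℓ
    Cover n s = ∀ i → i < n → C ⊆ E i → s ∈ E i

    A∩Cover-bounded : ∀ {N} → (∀ s → N ≤ s → s ∉ Accepted) →
                      ∃ λ M → ∀ s → s ∈ A → s ∈ Cover (count N) → s < M
    A∩Cover-bounded {N} none with common-refutation-stage (count N)
    -- From `M` on, the unrefuted inclusions are true; from `N` on, the count no longer grows. Past
    -- both, an element of `A` in the cover would be accepted.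
    ... | M , stage = M ⊔ N , λ s s∈A s∈Q → ≰⇒> λ ≤s →
      let N≤s = m⊔n≤o⇒n≤o M N ≤s in
      none s N≤s (s∈A , λ i i<n unref →
        let i<count = ≤-trans i<n (count-stops none N≤s) in
        s∈Q i i<count (stage i i<count s (m⊔n≤o⇒m≤o M N ≤s) unref))

    -- Recursiveness of the selection

    module _ {a c : Rec 1} {e : Rec 2}
             (ha : ∀ s → HasTruthValue a (s ∷ []) (s ∈ A))
             (hc : ∀ s → HasTruthValue c (s ∷ []) (s ∈ C))
             (he : ∀ i s → HasTruthValue e (i ∷ s ∷ []) (s ∈ E i)) where

      -- The stage precedes the index, opposite to `Unrefuted`, because `allᴿ` takes its bound as
      -- first argument.
      unrefutedᴿ : Rec 2
      unrefutedᴿ = allᴿ (reindex c (zero ∷ []) ⇒ᴿ reindex e (suc zero ∷ zero ∷ []))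

      truth-unrefuted : ∀ i s → HasTruthValue unrefutedᴿ (s ∷ i ∷ []) (Unrefuted i s)
      truth-unrefuted i = truth-all λ s →
        truth-⇒ (truth-reindex (zero ∷ []) (hc s)) (truth-reindex (suc zero ∷ zero ∷ []) (he i s))

      admissibleᴿ : Rec 2
      admissibleᴿ = reindex a (suc zero ∷ []) ∧ᴿ
                    allᴿ (reindex unrefutedᴿ (suc zero ∷ zero ∷ []) ⇒ᴿ e)

      truth-admissible : ∀ n s → HasTruthValue admissibleᴿ (n ∷ s ∷ []) (Admissible n s)
      truth-admissible n s =
        truth-∧ (truth-reindex (suc zero ∷ []) (ha s))
          (truth-all (λ i → truth-⇒ (truth-reindex (suc zero ∷ zero ∷ []) (truth-unrefuted i s)) (he i s)) n)

      countᴿ : Rec 1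
      countᴿ = prec zeroᴿ
        (comp addᴿ (reindex admissibleᴿ (suc zero ∷ zero ∷ []) ∷ proj (suc zero) ∷ []))

      ⇓-count : ∀ s → countᴿ [ s ∷ [] ]⇓ count s
      ⇓-count zero    = ⇓-prec-zero ⇓-zero
      ⇓-count (suc s) = ⇓-prec-suc (⇓-count s)
        (⇓-comp (⇓-indicator (truth-reindex (suc zero ∷ zero ∷ []) (truth-admissible (count s) s)) ∷ ⇓-proj ∷ [])
          (⇓-add _ (count s)))

      acceptedᴿ : Rec 1
      acceptedᴿ = comp admissibleᴿ (countᴿ ∷ proj zero ∷ [])

      truth-accepted : ∀ s → HasTruthValue acceptedᴿ (s ∷ []) (s ∈ Accepted)
      truth-accepted s = truth-comp (⇓-count s ∷ ⇓-proj ∷ []) (truth-admissible (count s) s)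

-- Transfer to words and the core property

theorem5p3 : ExcludedMiddle 0ℓ →
    ∀ {ℓ : Level} {X : Set} {m : ℕ} (enum : X ↔ Fin (suc m))
    (𝓛 : LanguageFamily X ℓ) →
    Nontrivial 𝓛 →
    WPRecursive enum 𝓛 →
    ClosedUnder∪ 𝓛 → ClosedUnder∩ 𝓛 → ClosedUnder∁ 𝓛 →
    (C A : Language X) →
    Recursive enum C → Recursive enum A →
    Infinite A → (A ∩ C) ≐ ∅ → A ∉ cclass₁ C 𝓛 →
    ∃ λ (B : Language X) → Recursive enum B × (B ⊆ A) × (B ∈ ccore₁ C 𝓛)
theorem5p3 em {X = X} enum 𝓛 (_ , U∈𝓛 , finite-change) (e , e∈𝓛 , e-onto , (fₑ , hₑ)) _ cl∩ cl∁
           C A (f_C , h_C) (f_A , h_A) A-infinite (A∩C⊆∅ , _) A∉cclass =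
  B , (acceptedᴿ h_A′ h_C′ h_E′ , λ w → truth-accepted h_A′ h_C′ h_E′ (code enum w))
    , B⊆A , B-infinite , B⊆∁C , no-separable-part
  where
  open Classical em

  dec : ℕ → List X
  dec = decode enum

  open Construction (λ s → dec s ∈ A) (λ s → dec s ∈ C) (λ i s → dec s ∈ e i)

  h_A′ : ∀ s → HasTruthValue f_A (s ∷ []) (dec s ∈ A)
  h_A′ s = subst (λ x → HasTruthValue f_A (x ∷ []) (dec s ∈ A)) (code-decode enum s) (h_A (dec s))

  h_C′ : ∀ s → HasTruthValue f_C (s ∷ []) (dec s ∈ C)
  h_C′ s = subst (λ x → HasTruthValue f_C (x ∷ []) (dec s ∈ C)) (code-decode enum s) (h_C (dec s))

  h_E′ : ∀ i s → HasTruthValue fₑ (i ∷ s ∷ []) (dec s ∈ e i)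
  h_E′ i s = subst (λ x → HasTruthValue fₑ (i ∷ x ∷ []) (dec s ∈ e i)) (code-decode enum s) (hₑ i (dec s))

  B : Language X
  B w = code enum w ∈ Accepted

  on-codes : ∀ (L : Language X) {w} → w ∈ L → dec (code enum w) ∈ L
  on-codes L = subst L (sym (decode-code enum _))

  off-codes : ∀ (L : Language X) {w} → dec (code enum w) ∈ L → w ∈ L
  off-codes L = subst L (decode-code enum _)

  B⊆A : B ⊆ A
  B⊆A (w∈A , _) = off-codes A w∈A

  B⊆∁C : B ⊆ ∁ C
  B⊆∁C w∈B w∈C = A∩C⊆∅ (B⊆A w∈B , w∈C)

  Coverʷ : ℕ → Language X
  Coverʷ n w = ∀ i → i < n → C ⊆ e i → w ∈ e i

  -- Induction from `U`: if `C ⊆ e n`, intersect with `e n`; otherwise the new condition is vacuous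
  -- and the language stays the same.
  Cover∈𝓛 : ∀ n → Coverʷ n ∈ᶠ 𝓛
  Cover∈𝓛 zero = respects 𝓛 ((λ _ _ ()) , _) U∈𝓛
  Cover∈𝓛 (suc n) with em {C ⊆ e n}
  ... | yes C⊆eₙ = respects 𝓛 (extend , restrict) (cl∩ _ _ (Cover∈𝓛 n) (e∈𝓛 n))
    where
    extend : Coverʷ n ∩ e n ⊆ Coverʷ (suc n)
    extend (h , w∈eₙ) i i<1+n C⊆eᵢ with m<1+n⇒m<n∨m≡n i<1+n
    ... | inj₁ i<n  = h i i<n C⊆eᵢ
    ... | inj₂ refl = w∈eₙ
    restrict : Coverʷ (suc n) ⊆ Coverʷ n ∩ e n
    restrict h = (λ i i<n → h i (m<n⇒m<1+n i<n)) , h n ≤-refl C⊆eₙ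
  ... | no C⊈eₙ = respects 𝓛 (extend , λ h i i<n → h i (m<n⇒m<1+n i<n)) (Cover∈𝓛 n)
    where
    extend : Coverʷ n ⊆ Coverʷ (suc n)
    extend h i i<1+n C⊆eᵢ with m<1+n⇒m<n∨m≡n i<1+n
    ... | inj₁ i<n  = h i i<n C⊆eᵢ
    ... | inj₂ refl = ⊥-elim (C⊈eₙ C⊆eᵢ)

  B-infinite : Infinite B
  B-infinite B-finite with finite⇒bounded enum B-finite
  ... | N , B<N = A∉cclass (A-infinite , A⊆∁C , Q′ , Q′∈𝓛 , cl∁ Q′ Q′∈𝓛 , C⊆Q′ , A⊆∁Q′)
    where
    none : ∀ s → N ≤ s → s ∉ Accepted
    none s N≤s acc = <⇒≱ (B<N {dec s} (subst Accepted (sym (code-decode enum s)) acc))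
                         (subst (N ≤_) (sym (code-decode enum s)) N≤s)
    A⊆∁C : A ⊆ ∁ C
    A⊆∁C w∈A w∈C = A∩C⊆∅ (w∈A , w∈C)
    Q′ : Language X
    -- Only words of `A` are removed, so none of `C` is lost, and they are finitely many, so the
    -- result stays in the family.
    Q′ = Coverʷ (count N) ∖ (A ∩ Coverʷ (count N))
    A∩Q-finite : Finite (A ∩ Coverʷ (count N))
    A∩Q-finite = bounded⇒finite enum λ {w} (w∈A , w∈Q) →
      proj₂ (A∩Cover-bounded none) (code enum w) (on-codes A w∈A)
        -- `Cover` refers to inclusions between sets of codes, `Coverʷ` to inclusions between
        -- languages; decoding turns the former into the latter.
        (λ i i<n C⊆Eᵢ → on-codes (e i) (w∈Q i i<n λ {v} v∈C → off-codes (e i) (C⊆Eᵢ {code enum v} (on-codes C v∈C))))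
    Q′∈𝓛 : Q′ ∈ᶠ 𝓛
    Q′∈𝓛 = proj₂ (finite-change _ _ (Cover∈𝓛 (count N)) A∩Q-finite)
    C⊆Q′ : C ⊆ Q′
    C⊆Q′ w∈C = (λ i _ C⊆eᵢ → C⊆eᵢ w∈C) , λ (w∈A , _) → A∩C⊆∅ (w∈A , w∈C)
    A⊆∁Q′ : A ⊆ ∁ Q′
    A⊆∁Q′ w∈A (w∈Q , w∉A∩Q) = w∉A∩Q (w∈A , w∈Q)

  Accepted-cofinal : Cofinal Accepted
  Accepted-cofinal N with em {∃ λ s → N ≤ s × s ∈ Accepted}
  ... | yes found = found
  ... | no none   = ⊥-elim (B-infinite (bounded⇒finite enum λ w∈B →
                      ≰⇒> λ N≤w → none (_ , N≤w , w∈B)))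

  no-separable-part : ∀ B′ → Infinite B′ → B′ ⊆ B → B′ ∉ cclass₁ C 𝓛
  no-separable-part B′ B′-infinite B′⊆B (_ , _ , Q , Q∈𝓛 , _ , C⊆Q , B′⊆∁Q) with e-onto Q Q∈𝓛
  ... | i , eᵢ⊆Q , Q⊆eᵢ with eventually-in Accepted-cofinal i (λ s∈C → Q⊆eᵢ (C⊆Q s∈C))
  -- A word of `B′` with code at least `N` would lie in `e i`, hence in `Q`, which `B′` avoids; so
  -- `N` bounds the codes of `B′`.
  ... | N , late = B′-infinite (bounded⇒finite enum λ w∈B′ → ≰⇒> λ N≤w →
          B′⊆∁Q w∈B′ (eᵢ⊆Q (off-codes (e i) (late _ N≤w (B′⊆B w∈B′)))))
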